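{- There is a constant $c>1/2$ such that for every integer $m\ge 2$ there exists $n_0=n_0(m)$ such that for every integer $n\ge n_0$ there exists a subset $A\subseteq \mathbb{Z}_m^n$ of size $|A|\ge (cm)^n$ not containing a three-term arithmetic progression. (The constant $c$ is absolute, i.e. independent of $m$ and $n$.)
   Context: $\mathbb{Z}_m=\mathbb{Z}/m\mathbb{Z}$ denotes the integers modulo $m$. A three-term arithmetic progression in $\mathbb{Z}_m^n$ consists of three distinct elements $x,y,z\in \mathbb{Z}_m^n$ with $x-2y+z=0$. A subset $A$ does not contain a three-term arithmetic progression if there are no three (pairwise) distinct elements $x,y,z\in A$ with $x-2y+z=0$. -}

module Defs where

open import Data.Fin using (Fin; toℕ)
open import Data.Integer using (+_)
open import Data.List using (List)
open import Data.List.Membership.Propositional using (_∈_)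
open import Data.Nat using (ℕ; _+_; _*_; _∸_; NonZero)
open import Data.Nat.DivMod using (_mod_)
open import Data.Product using (_×_)
open import Data.Rational as ℚ using (ℚ)
open import Algebra.Definitions.RawSemiring ℚ.+-*-rawSemiring public using (_^_)
open import Data.Vec using (Vec; zipWith; map; replicate)
open import Relation.Binary.PropositionalEquality using (_≡_; _≢_)
open import Relation.Nullary using (¬_)

-- Residue classes modulo m are represented by their representatives in
-- {0, …, m - 1}; each operation is computed in ℕ and reduced modulo m.

ℤmod : ℕ → Set
ℤmod m = Fin m

module _ {m : ℕ} .{{_ : NonZero m}} where

  infixl 6 _+ₘ_ _-ₘ_
  infixr 7 _·ₘ_

  0ₘ : ℤmod m
  0ₘ = 0 mod m

  _+ₘ_ : ℤmod m → ℤmod m → ℤmod m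
  x +ₘ y = (toℕ x + toℕ y) mod m

  -- m ∸ toℕ y is not truncated, since toℕ y < m.
  _-ₘ_ : ℤmod m → ℤmod m → ℤmod m
  x -ₘ y = (toℕ x + (m ∸ toℕ y)) mod m

  _·ₘ_ : ℕ → ℤmod m → ℤmod m
  k ·ₘ x = (k * toℕ x) mod m

ℤmod^ : ℕ → ℕ → Set
ℤmod^ m n = Vec (ℤmod m) n

module _ {m n : ℕ} .{{_ : NonZero m}} where

  infixl 6 _+ᵥ_ _-ᵥ_
  infixr 7 _·ᵥ_

  0ᵥ : ℤmod^ m n
  0ᵥ = replicate n 0ₘ

  _+ᵥ_ : ℤmod^ m n → ℤmod^ m n → ℤmod^ m n
  _+ᵥ_ = zipWith _+ₘ_

  _-ᵥ_ : ℤmod^ m n → ℤmod^ m n → ℤmod^ m n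
  _-ᵥ_ = zipWith _-ₘ_

  _·ᵥ_ : ℕ → ℤmod^ m n → ℤmod^ m n
  k ·ᵥ x = map (k ·ₘ_) x

  IsThreeTermAP : ℤmod^ m n → ℤmod^ m n → ℤmod^ m n → Set
  IsThreeTermAP x y z =
    x ≢ y × y ≢ z × x ≢ z × x -ᵥ 2 ·ᵥ y +ᵥ z ≡ 0ᵥ

  -- A finite subset is given by a list of its elements; its size is the
  -- length of the list only when the list is also required to be Unique.
  ThreeAPFree : List (ℤmod^ m n) → Set
  ThreeAPFree A = ∀ {x y z} → x ∈ A → y ∈ A → z ∈ A → ¬ IsThreeTermAP x y z

-- Constants and bounds are rational: a real c > 1/2 satisfying the lower bounds
-- (c m)^n can always be replaced by a smaller rational c > 1/2.

fromℕ : ℕ → ℚ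
fromℕ k = + k ℚ./ 1

{-# OPTIONS --safe #-}

-- Call φ : ℤₘᵏ → ℕ strictly convex on B ⊆ ℤₘᵏ if x - 2y + z = 0 in B forces 2φ(y) < φ(x) + φ(z),
-- or x = z and φ(x) = φ(y). The condition passes to Bᴺ with the sum of the φ-values, a level set of
-- a strictly convex function is free of three-term progressions, and Bᴺ has a level set of size at
-- least |B|ᴺ / O(N). So it suffices to find B with |B| > (c m)ᵏ.
--
-- For bounded m, k = 1 and B = {0, …, ⌊m/2⌋} will do. For large m take k = 2 and B the union of 18
-- of the 64 cells of an 8 × 8 grid on the torus, so that |B| ≈ (18/64) m² > m²/4. The dominant term of
-- φ(s , t) is a multiple of s². The rows with s ≥ m/2 are usable, although s-progressions may wrap
-- around there, since the choice of t excludes the wraps s₁ + s₃ + m = 2s₂, and wraps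
-- s₁ + s₃ = 2s₂ + m only help convexity. Progressions with constant s are handled by the square of
-- the representative of 2t, which allows t-ranges containing both t and t + m/2.

module Submission where

open import Defs
open import Algebra.Bundles using (CommutativeMonoid)
open import Data.Fin as Fin using (Fin; toℕ; #_; fromℕ<; inject≤)
open import Data.Fin.Properties as Fin using (toℕ-fromℕ<; toℕ-inject≤; toℕ-injective; toℕ<n; inject≤-injective)
import Data.Integer as ℤ
import Data.Integer.Properties as ℤ
open import Data.List as List using (List; []; _∷_; length; filter; allFin; cartesianProduct; cartesianProductWith)
open import Data.List.Extrema.Nat using (max; xs≤max)
open import Data.List.Membership.Propositional using (_∈_)
open import Data.List.Membership.Propositional.Properties
  using (∈-map⁺; ∈-map⁻; ∈-filter⁻; ∈-cartesianProduct⁻; ∈-cartesianProductWith⁻)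
open import Data.List.Properties using (length-++; length-map; length-tabulate; filter-all)
open import Data.List.Relation.Unary.All as All using (All; []; _∷_; all?)
open import Data.List.Relation.Unary.AllPairs using ([]; _∷_)
open import Data.List.Relation.Unary.Any using (here)
import Data.List.Relation.Unary.Unique.DecPropositional as DecUnique
open import Data.List.Relation.Unary.Unique.Propositional using (Unique)
import Data.List.Relation.Unary.Unique.Propositional.Properties as Unique
open import Data.Nat as ℕ hiding (_^_)
open import Data.Nat.DivMod
open import Data.Nat.Divisibility using (_∣_; quotient; m%n≡0⇒n∣m; m∣n⇒n≡quotient*m)
open import Data.Nat.Properties
open import Data.Nat.Tactic.RingSolver using (solve-∀)
open import Data.Product using (∃-syntax; _×_; _,_; proj₁; proj₂)
import Data.Product.Properties as Product
open import Data.Rational as ℚ using (ℚ; ½)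
import Data.Rational.Properties as ℚ
import Data.Rational.Unnormalised as ℚᵘ
import Data.Rational.Unnormalised.Properties as ℚᵘ
open import Data.Sum as Sum using (_⊎_; inj₁; inj₂; [_,_]′)
open import Data.Vec as Vec using (Vec; []; _∷_; _++_; replicate)
import Data.Vec.Properties as Vec
open import Function using (_∘_; id)
open import Relation.Binary.PropositionalEquality
open import Relation.Nullary using (¬_; Dec; yes; no; contradiction; from-yes; ¬?; _×-dec_; _⊎-dec_; _→-dec_)
open import Relation.Unary using (Pred; Decidable)
open import Algebra.Properties.CommutativeSemigroup
  (CommutativeMonoid.commutativeSemigroup ℚ.*-1-commutativeMonoid) using (interchange)

-- Powers of the constant as inequalities in ℕ

fromℕ≃ : ∀ k → ℚ.toℚᵘ (fromℕ k) ℚᵘ.≃ (ℚᵘ.mkℚᵘ (ℤ.+ k) 0)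
fromℕ≃ k = ℚ.toℚᵘ-fromℚᵘ (ℚᵘ.mkℚᵘ (ℤ.+ k) 0)

fromℕ-* : ∀ a b → fromℕ (a * b) ≡ fromℕ a ℚ.* fromℕ b
fromℕ-* a b = ℚ.toℚᵘ-injective (begin
  ℚ.toℚᵘ (fromℕ (a * b))                       ≈⟨ fromℕ≃ (a * b) ⟩
  ℚᵘ.mkℚᵘ (ℤ.+ (a * b)) 0                        ≡⟨ cong (λ i → ℚᵘ.mkℚᵘ i 0) (ℤ.pos-* a b) ⟩
  ℚᵘ.mkℚᵘ (ℤ.+ a) 0 ℚᵘ.* ℚᵘ.mkℚᵘ (ℤ.+ b) 0         ≈⟨ ℚᵘ.*-cong (fromℕ≃ a) (fromℕ≃ b) ⟨
  ℚ.toℚᵘ (fromℕ a) ℚᵘ.* ℚ.toℚᵘ (fromℕ b)       ≈⟨ ℚ.toℚᵘ-homo-* (fromℕ a) (fromℕ b) ⟨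
  ℚ.toℚᵘ (fromℕ a ℚ.* fromℕ b)                 ∎)
  where open ℚᵘ.≃-Reasoning

fromℕ-mono-≤ : ∀ {a b} → a ≤ b → fromℕ a ℚ.≤ fromℕ b
fromℕ-mono-≤ {a} {b} a≤b = ℚ.toℚᵘ-cancel-≤ (begin
  ℚ.toℚᵘ (fromℕ a) ≃⟨ fromℕ≃ a ⟩
  ℚᵘ.mkℚᵘ (ℤ.+ a) 0  ≤⟨ ℚᵘ.*≤* (ℤ.*-monoʳ-≤-nonNeg (ℤ.+ 1) (ℤ.+≤+ a≤b)) ⟩
  ℚᵘ.mkℚᵘ (ℤ.+ b) 0  ≃⟨ fromℕ≃ b ⟨
  ℚ.toℚᵘ (fromℕ b) ∎)
  where open ℚᵘ.≤-Reasoning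

fromℕ-positive : ∀ a → .{{NonZero a}} → ℚ.Positive (fromℕ a)
fromℕ-positive (suc a) = ℚ.normalize-pos (suc a) 1

-- Slightly above 1/2, and below two densities: (⌊m/2⌋ + 1) / m for m < 256, and √18 / 8 ≈ 0.53, the
-- density per coordinate of 18 cells out of 64.
c₀ : ℚ
c₀ = ℤ.+ 257 ℚ./ 512

-- Clears the denominator 512 in every factor, so that all later estimates take place in ℕ.
c₀-power : ∀ m n → fromℕ (512 ℕ.^ n) ℚ.* (c₀ ℚ.* fromℕ m) ^ n ≡ fromℕ ((257 * m) ℕ.^ n)
c₀-power m zero = refl
c₀-power m (suc n) = begin
  fromℕ (512 * 512 ℕ.^ n) ℚ.* (x ℚ.* x ^ n)              ≡⟨ cong (ℚ._* (x ℚ.* x ^ n)) (fromℕ-* 512 (512 ℕ.^ n)) ⟩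
  (fromℕ 512 ℚ.* fromℕ (512 ℕ.^ n)) ℚ.* (x ℚ.* x ^ n)    ≡⟨ interchange (fromℕ 512) (fromℕ (512 ℕ.^ n)) x (x ^ n) ⟩
  (fromℕ 512 ℚ.* x) ℚ.* (fromℕ (512 ℕ.^ n) ℚ.* x ^ n)    ≡⟨ cong₂ ℚ._*_ step (c₀-power m n) ⟩
  fromℕ (257 * m) ℚ.* fromℕ ((257 * m) ℕ.^ n)            ≡⟨ fromℕ-* (257 * m) ((257 * m) ℕ.^ n) ⟨
  fromℕ (257 * m * (257 * m) ℕ.^ n)                      ∎
  where
  open ≡-Reasoning
  x = c₀ ℚ.* fromℕ m
  step : fromℕ 512 ℚ.* x ≡ fromℕ (257 * m)
  step = trans (sym (ℚ.*-assoc (fromℕ 512) c₀ (fromℕ m))) (sym (fromℕ-* 257 m))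

c₀-power-≤ : ∀ m n l → (257 * m) ℕ.^ n ≤ 512 ℕ.^ n * l → fromℕ l ℚ.≥ (c₀ ℚ.* fromℕ m) ^ n
c₀-power-≤ m n l le = ℚ.*-cancelˡ-≤-pos (fromℕ (512 ℕ.^ n)) {{fromℕ-positive _ {{m^n≢0 512 n}}}} (begin
  fromℕ (512 ℕ.^ n) ℚ.* (c₀ ℚ.* fromℕ m) ^ n  ≡⟨ c₀-power m n ⟩
  fromℕ ((257 * m) ℕ.^ n)                     ≤⟨ fromℕ-mono-≤ le ⟩
  fromℕ (512 ℕ.^ n * l)                       ≡⟨ fromℕ-* (512 ℕ.^ n) l ⟩
  fromℕ (512 ℕ.^ n) ℚ.* fromℕ l               ∎)
  where open ℚ.≤-Reasoning

-- Exponential against linear growth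

[a*b]^n≡a^n*b^n : ∀ a b n → (a * b) ℕ.^ n ≡ a ℕ.^ n * b ℕ.^ n
[a*b]^n≡a^n*b^n a b zero    = refl
[a*b]^n≡a^n*b^n a b (suc n) = trans (cong (a * b *_) ([a*b]^n≡a^n*b^n a b n)) ([m*n]*[o*p]≡[m*o]*[n*p] a b _ _)

-- The binomial coefficient C(n, 2), defined without division.
triangular : ℕ → ℕ
triangular zero    = 0
triangular (suc n) = triangular n + n

-- Among the pairs from n + k elements, `n * k` have one element in each of two blocks of sizes n
-- and k.
n*k≤triangular[n+k] : ∀ n k → n * k ≤ triangular (n + k)
n*k≤triangular[n+k] zero    k = z≤n
n*k≤triangular[n+k] (suc n) k = begin
  k + n * k                   ≡⟨ +-comm k (n * k) ⟩
  n * k + k                   ≤⟨ +-mono-≤ (n*k≤triangular[n+k] n k) (m≤n+m k n) ⟩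
  triangular (n + k) + (n + k) ∎
  where open ≤-Reasoning

-- The linear term n a^(n-1) in the binomial expansion of (1 + a)^n, multiplied by a.
n*a^n≤a*[1+a]^n : ∀ a n → n * a ℕ.^ n ≤ a * suc a ℕ.^ n
n*a^n≤a*[1+a]^n a zero    = z≤n
n*a^n≤a*[1+a]^n a (suc n) = begin
  suc n * (a * a ℕ.^ n)                         ≡⟨ lemma n a (a ℕ.^ n) ⟩
  a * a ℕ.^ n + a * (n * a ℕ.^ n)               ≤⟨ +-mono-≤ (*-monoʳ-≤ a (^-monoˡ-≤ n (n≤1+n a))) (*-monoʳ-≤ a (n*a^n≤a*[1+a]^n a n)) ⟩
  a * suc a ℕ.^ n + a * (a * suc a ℕ.^ n)       ≡⟨ lemma′ a (suc a ℕ.^ n) ⟩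
  a * (suc a * suc a ℕ.^ n)                     ∎
  where
  open ≤-Reasoning
  lemma : ∀ n a p → suc n * (a * p) ≡ a * p + a * (n * p)
  lemma = solve-∀
  lemma′ : ∀ a p → a * p + a * (a * p) ≡ a * (suc a * p)
  lemma′ = solve-∀

-- Likewise the quadratic term C(n, 2) a^(n-2), multiplied by a².
triangular[n]*a^n≤a²*[1+a]^n : ∀ a n → triangular n * a ℕ.^ n ≤ a * a * suc a ℕ.^ n
triangular[n]*a^n≤a²*[1+a]^n a zero    = z≤n
triangular[n]*a^n≤a²*[1+a]^n a (suc n) = begin
  (triangular n + n) * (a * a ℕ.^ n)                    ≡⟨ lemma (triangular n) n a (a ℕ.^ n) ⟩
  a * (triangular n * a ℕ.^ n) + a * (n * a ℕ.^ n)      ≤⟨ +-mono-≤ (*-monoʳ-≤ a (triangular[n]*a^n≤a²*[1+a]^n a n)) (*-monoʳ-≤ a (n*a^n≤a*[1+a]^n a n)) ⟩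
  a * (a * a * suc a ℕ.^ n) + a * (a * suc a ℕ.^ n)     ≡⟨ lemma′ a (suc a ℕ.^ n) ⟩
  a * a * (suc a * suc a ℕ.^ n)                         ∎
  where
  open ≤-Reasoning
  lemma : ∀ t n a p → (t + n) * (a * p) ≡ a * (t * p) + a * (n * p)
  lemma = solve-∀
  lemma′ : ∀ a p → a * (a * a * p) + a * (a * p) ≡ a * a * (suc a * p)
  lemma′ = solve-∀

-- Since b ≥ 1 + a, the ratio b^N / a^N is at least C(N, 2) / a², which is quadratic in N.
exponential-beats-linear : ∀ a b e f → .{{NonZero a}} → a < b →
  ∃[ N₀ ] (∀ N → N ≥ N₀ → a ℕ.^ N * (e * suc (N * f)) ≤ b ℕ.^ N)
exponential-beats-linear a b e f a<b = K + suc K , bound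
  where
  open ≤-Reasoning
  -- Chosen so that for N = M + K with M > K the linear side, multiplied by a², is at most `M * K`,
  -- a lower bound for C(N, 2). The threshold `K + suc K` provides such an M.
  K = a * a * e * (2 * suc f)
  linear≤triangular : ∀ M → M ≥ suc K → a * a * (e * suc ((M + K) * f)) ≤ triangular (M + K)
  linear≤triangular M@(suc M-1) M>K = begin
    a * a * (e * suc ((M + K) * f))      ≤⟨ *-monoʳ-≤ (a * a) (*-monoʳ-≤ e (+-mono-≤ {1} {M} (s≤s z≤n) (*-monoˡ-≤ f (+-monoʳ-≤ M (≤-trans (n≤1+n K) M>K))))) ⟩
    a * a * (e * (M + (M + M) * f))      ≤⟨ *-monoʳ-≤ (a * a) (*-monoʳ-≤ e (+-monoˡ-≤ ((M + M) * f) (m≤m+n M M))) ⟩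
    a * a * (e * ((M + M) + (M + M) * f)) ≡⟨ lemma a e M f ⟩
    M * K                                ≤⟨ n*k≤triangular[n+k] M K ⟩
    triangular (M + K)                   ∎
    where
    lemma : ∀ a e M f → a * a * (e * ((M + M) + (M + M) * f)) ≡ M * (a * a * e * (2 * suc f))
    lemma = solve-∀
  bound′ : ∀ M → M ≥ suc K → a ℕ.^ (M + K) * (e * suc ((M + K) * f)) ≤ b ℕ.^ (M + K)
  bound′ M M>K = *-cancelˡ-≤ (a * a) {{m*n≢0 a a}} (begin
    a * a * (a ℕ.^ N * (e * suc (N * f)))   ≡⟨ lemma (a * a) (a ℕ.^ N) _ ⟩
    a * a * (e * suc (N * f)) * a ℕ.^ N     ≤⟨ *-monoˡ-≤ (a ℕ.^ N) (linear≤triangular M M>K) ⟩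
    triangular N * a ℕ.^ N                  ≤⟨ triangular[n]*a^n≤a²*[1+a]^n a N ⟩
    a * a * suc a ℕ.^ N                     ≤⟨ *-monoʳ-≤ (a * a) (^-monoˡ-≤ N a<b) ⟩
    a * a * b ℕ.^ N                         ∎)
    where
    N = M + K
    lemma : ∀ x y z → x * (y * z) ≡ x * z * y
    lemma = solve-∀
  bound : ∀ N → N ≥ K + suc K → a ℕ.^ N * (e * suc (N * f)) ≤ b ℕ.^ N
  bound N N≥ with d , refl ← m≤n⇒∃[o]m+o≡n N≥ =
    subst (λ N → a ℕ.^ N * (e * suc (N * f)) ≤ b ℕ.^ N) (lemma K d) (bound′ (suc K + d) (m≤m+n (suc K) d))
    where
    lemma : ∀ K d → suc K + d + K ≡ K + suc K + d
    lemma = solve-∀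

-- Pigeonhole principle for level sets

length-filter-⊎ : ∀ {a p q r} {A : Set a} {P : Pred A p} {Q : Pred A q} {R : Pred A r}
  (P? : Decidable P) (Q? : Decidable Q) (R? : Decidable R) → (∀ {x} → P x → Q x ⊎ R x) →
  ∀ xs → length (filter P? xs) ≤ length (filter Q? xs) + length (filter R? xs)
length-filter-⊎ P? Q? R? split [] = z≤n
length-filter-⊎ P? Q? R? split (x ∷ xs) with ih ← length-filter-⊎ P? Q? R? split xs | P? x | Q? x | R? x
... | yes _ | yes _ | yes _ = s≤s (≤-trans ih (+-monoʳ-≤ _ (n≤1+n _)))
... | yes _ | yes _ | no _  = s≤s ih
... | yes _ | no _  | yes _ = ≤-trans (s≤s ih) (≤-reflexive (sym (+-suc _ _)))
... | yes p | no ¬q | no ¬r = contradiction (split p) λ { (inj₁ q) → ¬q q ; (inj₂ r) → ¬r r }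
... | no _  | yes _ | yes _ = ≤-trans ih (≤-trans (+-monoʳ-≤ _ (n≤1+n _)) (n≤1+n _))
... | no _  | yes _ | no _  = ≤-trans ih (n≤1+n _)
... | no _  | no _  | yes _ = ≤-trans ih (+-monoʳ-≤ _ (n≤1+n _))
... | no _  | no _  | no _  = ih

module _ {a} {A : Set a} (f : A → ℕ) where

  fibre : ℕ → List A → List A
  fibre v = filter (λ x → f x ≟ v)

  length-filter-<suc : ∀ s xs → length (filter (λ x → f x <? suc s) xs) ≤ length (filter (λ x → f x <? s) xs) + length (fibre s xs)
  length-filter-<suc s = length-filter-⊎ _ _ _ (m≤n⇒m<n∨m≡n ∘ s≤s⁻¹)

  -- Induction on the number of values: the new level set `s` is compared with the best one so far,
  -- and the larger is kept.
  large-fibre-< : ∀ s xs → ∃[ v ] length (filter (λ x → f x <? s) xs) ≤ s * length (fibre v xs)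
  large-fibre-< zero xs = 0 , ≤-reflexive (cong length (none xs))
    where
    none : ∀ xs → filter (λ x → f x <? 0) xs ≡ []
    none []       = refl
    none (x ∷ xs) = none xs
  large-fibre-< (suc s) xs with v , le ← large-fibre-< s xs | ≤-total (length (fibre s xs)) (length (fibre v xs))
  ... | inj₁ s≤v = v , ≤-trans (length-filter-<suc s xs) (≤-trans (+-mono-≤ le s≤v) (≤-reflexive (+-comm (s * length (fibre v xs)) _)))
  ... | inj₂ v≤s = s , ≤-trans (length-filter-<suc s xs) (≤-trans (+-monoˡ-≤ _ (≤-trans le (*-monoʳ-≤ s v≤s))) (≤-reflexive (+-comm (s * length (fibre s xs)) _)))

  large-fibre : ∀ s xs → (∀ {x} → x ∈ xs → f x < s) → ∃[ v ] length xs ≤ s * length (fibre v xs)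
  large-fibre s xs f< with v , le ← large-fibre-< s xs =
    v , subst (λ ys → length ys ≤ s * length (fibre v xs)) (filter-all (λ x → f x <? s) (All.tabulate f<)) le

-- Products of lists and concatenation of vectors

length-cartesianProductWith : ∀ {a b c} {A : Set a} {B : Set b} {C : Set c} (f : A → B → C) xs ys →
  length (cartesianProductWith f xs ys) ≡ length xs * length ys
length-cartesianProductWith f []       ys = refl
length-cartesianProductWith f (x ∷ xs) ys =
  trans (length-++ (List.map (f x) ys)) (cong₂ _+_ (length-map (f x) ys) (length-cartesianProductWith f xs ys))

replicate-++ : ∀ {a} {A : Set a} k n (x : A) → replicate (k + n) x ≡ replicate k x ++ replicate n x
replicate-++ zero    n x = refl
replicate-++ (suc k) n x = cong (x ∷_) (replicate-++ k n x)

take-++ : ∀ {a} {A : Set a} {k n} (xs : Vec A k) (ys : Vec A n) → Vec.take k (xs ++ ys) ≡ xs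
take-++ {k = k} xs ys = Vec.++-injectiveˡ _ xs (Vec.take++drop≡id k (xs ++ ys))

drop-++ : ∀ {a} {A : Set a} {k n} (xs : Vec A k) (ys : Vec A n) → Vec.drop k (xs ++ ys) ≡ ys
drop-++ {k = k} xs ys = Vec.++-injectiveʳ (Vec.take k (xs ++ ys)) xs (Vec.take++drop≡id k (xs ++ ys))

-- Strictly convex functions and their sums

module _ {m : ℕ} .{{_ : NonZero m}} where

  -- For even m, x = z and 2x = 2y do not imply x = y, so the first alternative asks only for equal
  -- values. This preserves the weak inequality `2 * φ y ≤ φ x + φ z`, on which sums rely.
  StrictlyConvexAt : ∀ {n} → (ℤmod^ m n → ℕ) → ℤmod^ m n → ℤmod^ m n → ℤmod^ m n → Set
  StrictlyConvexAt φ x y z = (x ≡ z × φ x ≡ φ y) ⊎ 2 * φ y < φ x + φ z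

  StrictlyConvexOn : ∀ {n} → List (ℤmod^ m n) → (ℤmod^ m n → ℕ) → Set
  StrictlyConvexOn A φ = ∀ {x y z} → x ∈ A → y ∈ A → z ∈ A →
    x -ᵥ 2 ·ᵥ y +ᵥ z ≡ 0ᵥ → StrictlyConvexAt φ x y z

  -- On a level set both sides of the strict inequality equal 2v, so only `x ≡ z` remains, contrary
  -- to distinctness.
  fibre-threeAPFree : ∀ {n} {A : List (ℤmod^ m n)} {φ} v → StrictlyConvexOn A φ → ThreeAPFree (fibre φ v A)
  fibre-threeAPFree {φ = φ} v convex x∈ y∈ z∈ (_ , _ , x≢z , eq)
    with x∈A , φx≡v ← ∈-filter⁻ (λ x → φ x ≟ v) x∈
       | y∈A , φy≡v ← ∈-filter⁻ (λ x → φ x ≟ v) y∈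
       | z∈A , φz≡v ← ∈-filter⁻ (λ x → φ x ≟ v) z∈
    with convex x∈A y∈A z∈A eq
  ... | inj₁ (x≡z , _) = x≢z x≡z
  ... | inj₂ lt rewrite φx≡v | φy≡v | φz≡v | +-identityʳ v = <-irrefl refl lt

  _⊞_ : ∀ {k n} → (ℤmod^ m k → ℕ) → (ℤmod^ m n → ℕ) → ℤmod^ m (k + n) → ℕ
  _⊞_ {k} φ ψ x = φ (Vec.take k x) + ψ (Vec.drop k x)

  ⊞-++ : ∀ {k n} (φ : ℤmod^ m k → ℕ) (ψ : ℤmod^ m n → ℕ) x y → (φ ⊞ ψ) (x ++ y) ≡ φ x + ψ y
  ⊞-++ φ ψ x y = cong₂ (λ u v → φ u + ψ v) (take-++ x y) (drop-++ x y)

  -- Both alternatives imply the weak inequality, so strictness in one component survives the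
  -- addition of the other. If neither is strict, both are degenerate, and so is the concatenation.
  strictlyConvexAt-++ : ∀ {k n} (φ : ℤmod^ m k → ℕ) (ψ : ℤmod^ m n → ℕ) x y z x′ y′ z′ →
    StrictlyConvexAt φ x y z → StrictlyConvexAt ψ x′ y′ z′ →
    StrictlyConvexAt (φ ⊞ ψ) (x ++ x′) (y ++ y′) (z ++ z′)
  strictlyConvexAt-++ φ ψ x y z x′ y′ z′ c c′
    rewrite ⊞-++ φ ψ x x′ | ⊞-++ φ ψ y y′ | ⊞-++ φ ψ z z′ = combine c c′
    where
    regroup : ∀ a b c d → (a + b) + (c + d) ≡ (a + c) + (b + d)
    regroup = solve-∀
    weak : ∀ {n} (χ : ℤmod^ m n → ℕ) x y z → StrictlyConvexAt χ x y z → 2 * χ y ≤ χ x + χ z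
    weak χ x y z (inj₁ (refl , eq)) = ≤-reflexive (cong₂ _+_ (sym eq) (trans (+-identityʳ _) (sym eq)))
    weak χ x y z (inj₂ lt)          = <⇒≤ lt
    strict : 2 * φ y + 2 * ψ y′ < (φ x + φ z) + (ψ x′ + ψ z′) → 2 * (φ y + ψ y′) < (φ x + ψ x′) + (φ z + ψ z′)
    strict = subst₂ _<_ (sym (*-distribˡ-+ 2 (φ y) (ψ y′))) (regroup (φ x) (φ z) (ψ x′) (ψ z′))
    combine : StrictlyConvexAt φ x y z → StrictlyConvexAt ψ x′ y′ z′ →
      (x ++ x′ ≡ z ++ z′ × φ x + ψ x′ ≡ φ y + ψ y′) ⊎ 2 * (φ y + ψ y′) < (φ x + ψ x′) + (φ z + ψ z′)
    combine (inj₁ (p , q)) (inj₁ (p′ , q′)) = inj₁ (cong₂ _++_ p p′ , cong₂ _+_ q q′)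
    combine (inj₂ lt) c′ = inj₂ (strict (+-mono-<-≤ lt (weak ψ x′ y′ z′ c′)))
    combine c@(inj₁ _) (inj₂ lt) = inj₂ (strict (+-mono-≤-< (weak φ x y z c) lt))

  AP-++⁻ : ∀ {k n} (x y z : ℤmod^ m k) (x′ y′ z′ : ℤmod^ m n) →
    (x ++ x′) -ᵥ 2 ·ᵥ (y ++ y′) +ᵥ (z ++ z′) ≡ 0ᵥ →
    x -ᵥ 2 ·ᵥ y +ᵥ z ≡ 0ᵥ × x′ -ᵥ 2 ·ᵥ y′ +ᵥ z′ ≡ 0ᵥ
  AP-++⁻ {k} {n} x y z x′ y′ z′ eq
    rewrite Vec.map-++ (2 ·ₘ_) y y′
          | Vec.zipWith-++ _-ₘ_ x x′ (2 ·ᵥ y) (2 ·ᵥ y′)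
          | Vec.zipWith-++ _+ₘ_ (x -ᵥ 2 ·ᵥ y) (x′ -ᵥ 2 ·ᵥ y′) z z′
          | replicate-++ k n (0ₘ {m})
    = Vec.++-injective _ 0ᵥ eq

  strictlyConvexOn-× : ∀ {k n} {A : List (ℤmod^ m k)} {B : List (ℤmod^ m n)} {φ ψ} →
    StrictlyConvexOn A φ → StrictlyConvexOn B ψ → StrictlyConvexOn (cartesianProductWith _++_ A B) (φ ⊞ ψ)
  strictlyConvexOn-× {A = A} {B} {φ} {ψ} convexA convexB x∈ y∈ z∈ eq
    with x , x′ , x∈A , x′∈B , refl ← ∈-cartesianProductWith⁻ _++_ A B x∈
       | y , y′ , y∈A , y′∈B , refl ← ∈-cartesianProductWith⁻ _++_ A B y∈
       | z , z′ , z∈A , z′∈B , refl ← ∈-cartesianProductWith⁻ _++_ A B z∈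
    with e , e′ ← AP-++⁻ x y z x′ y′ z′ eq
    = strictlyConvexAt-++ φ ψ x y z x′ y′ z′ (convexA x∈A y∈A z∈A e) (convexB x′∈B y′∈B z′∈B e′)

-- Powers of a block

-- Equal to `N * k + r`, but unfolding to `k + _`, so that concatenation with a block needs no
-- transport.
powerDim : ℕ → ℕ → ℕ → ℕ
powerDim k r zero    = r
powerDim k r (suc N) = k + powerDim k r N

powerDim≡ : ∀ k r N → powerDim k r N ≡ N * k + r
powerDim≡ k r zero    = refl
powerDim≡ k r (suc N) = trans (cong (k +_) (powerDim≡ k r N)) (sym (+-assoc k (N * k) r))

module Power {m k : ℕ} .{{_ : NonZero m}} {B : List (ℤmod^ m k)} {φ : ℤmod^ m k → ℕ} {Φ}
  (B! : Unique B) (convex : StrictlyConvexOn B φ) (φ≤Φ : ∀ {x} → x ∈ B → φ x ≤ Φ) (r : ℕ) where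

  power : ∀ N → List (ℤmod^ m (powerDim k r N))
  -- The r coordinates left over after N blocks are fixed to 0.
  power zero    = 0ᵥ ∷ []
  power (suc N) = cartesianProductWith _++_ B (power N)

  φ^ : ∀ N → ℤmod^ m (powerDim k r N) → ℕ
  φ^ zero    = λ _ → 0
  φ^ (suc N) = φ ⊞ φ^ N

  power! : ∀ N → Unique (power N)
  power! zero    = [] ∷ []
  power! (suc N) = Unique.cartesianProductWith⁺ _++_ (Vec.++-injective _ _) B! (power! N)

  power-convex : ∀ N → StrictlyConvexOn (power N) (φ^ N)
  power-convex zero (here refl) (here refl) (here refl) _ = inj₁ (refl , refl)
  power-convex (suc N) = strictlyConvexOn-× convex (power-convex N)

  φ^≤ : ∀ N {x} → x ∈ power N → φ^ N x ≤ N * Φ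
  φ^≤ zero    _ = z≤n
  φ^≤ (suc N) x∈ with x , y , x∈B , y∈ , refl ← ∈-cartesianProductWith⁻ _++_ B (power N) x∈
    rewrite ⊞-++ φ (φ^ N) x y = +-mono-≤ (φ≤Φ x∈B) (φ^≤ N y∈)

  length-power : ∀ N → length (power N) ≡ length B ℕ.^ N
  length-power zero    = refl
  length-power (suc N) = trans (length-cartesianProductWith _++_ B (power N)) (cong (length B *_) (length-power N))

  -- The values of `φ^ N` lie between 0 and `N * Φ`, so there are at most `suc (N * Φ)` level sets.
  large-threeAPFree : ∀ N → ∃[ A ] Unique {A = ℤmod^ m (powerDim k r N)} A × ThreeAPFree A ×
    length B ℕ.^ N ≤ suc (N * Φ) * length A
  large-threeAPFree N with v , le ← large-fibre (φ^ N) (suc (N * Φ)) (power N) (s≤s ∘ φ^≤ N) =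
    fibre (φ^ N) v (power N) ,
    Unique.filter⁺ _ (power! N) ,
    fibre-threeAPFree v (power-convex N) ,
    ≤-trans (≤-reflexive (sym (length-power N))) le

-- From a dense block to large progression-free sets

HasLargeSet : (m n : ℕ) .{{_ : NonZero m}} → Set
HasLargeSet m n = ∃[ A ] Unique {A = ℤmod^ m n} A × ThreeAPFree A × fromℕ (length A) ℚ.≥ (c₀ ℚ.* fromℕ m) ^ n

HasLargeSets : (m : ℕ) .{{_ : NonZero m}} → Set
HasLargeSets m = ∃[ n₀ ] (∀ n → n ≥ n₀ → HasLargeSet m n)

-- Write n = N k + r with r < k. By the strict density hypothesis each block gains a constant factor
-- above 1. Their product eventually outweighs the factor `suc (N * Φ)` lost to the pigeonhole
-- principle and the factor (257 m)^r lost to the fixed coordinates.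
bounded⇒hasLargeSets : ∀ {m k} .{{_ : NonZero m}} .{{_ : NonZero k}} {B : List (ℤmod^ m k)} {φ : ℤmod^ m k → ℕ} Φ →
  (∀ {x} → x ∈ B → φ x ≤ Φ) →
  Unique B → StrictlyConvexOn B φ → (257 * m) ℕ.^ k < length B * 512 ℕ.^ k →
  HasLargeSets m
bounded⇒hasLargeSets {m} {k} {B} {φ} Φ φ≤Φ B! convex dense
  = N₀ * k , λ n n≥ → subst (λ n → HasLargeSet m n) (dim n) (at (n / k) (n % k) (<⇒≤ (m%n<n n k)) (quotient-large n n≥))
  where
  -- The third argument (257 m)^k covers the loss (257 m)^r for all r ≤ k at once, so that `N₀` does
  -- not depend on n.
  eventually = exponential-beats-linear ((257 * m) ℕ.^ k) (512 ℕ.^ k * length B) ((257 * m) ℕ.^ k) Φ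
    {{m^n≢0 (257 * m) k {{m*n≢0 257 m}}}} (<-≤-trans dense (≤-reflexive (*-comm (length B) (512 ℕ.^ k))))
  N₀     = proj₁ eventually
  growth = proj₂ eventually
  dim : ∀ n → powerDim k (n % k) (n / k) ≡ n
  dim n = trans (powerDim≡ k (n % k) (n / k)) (trans (+-comm (n / k * k) (n % k)) (sym (m≡m%n+[m/n]*n n k)))
  quotient-large : ∀ n → n ≥ N₀ * k → n / k ≥ N₀
  quotient-large n n≥ = subst (_≤ n / k) (m*n/n≡m N₀ k) (/-monoˡ-≤ k n≥)
  at : ∀ N r → r ≤ k → N ≥ N₀ → HasLargeSet m (powerDim k r N)
  at N r r≤k N≥ with A , A! , free , le ← Power.large-threeAPFree B! convex φ≤Φ r N =
    A , A! , free , c₀-power-≤ m n (length A) (*-cancelʳ-≤ _ _ (suc (N * Φ)) bound)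
    where
    open ≤-Reasoning
    n = powerDim k r N
    p = 257 * m
    instance _ = m*n≢0 257 m
    split : ∀ q → q ℕ.^ n ≡ (q ℕ.^ k) ℕ.^ N * q ℕ.^ r
    split q = trans (cong (q ℕ.^_) (trans (powerDim≡ k r N) (cong (_+ r) (*-comm N k))))
      (trans (^-distribˡ-+-* q (k * N) r) (cong (_* q ℕ.^ r) (sym (^-*-assoc q k N))))
    rearrange : ∀ x y z → x * (y * z) ≡ x * z * y
    rearrange = solve-∀
    bound : p ℕ.^ n * suc (N * Φ) ≤ 512 ℕ.^ n * length A * suc (N * Φ)
    bound = begin
      p ℕ.^ n * suc (N * Φ)                              ≡⟨ cong (_* suc (N * Φ)) (split p) ⟩
      (p ℕ.^ k) ℕ.^ N * p ℕ.^ r * suc (N * Φ)            ≡⟨ *-assoc ((p ℕ.^ k) ℕ.^ N) _ _ ⟩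
      (p ℕ.^ k) ℕ.^ N * (p ℕ.^ r * suc (N * Φ))          ≤⟨ *-monoʳ-≤ ((p ℕ.^ k) ℕ.^ N) (*-monoˡ-≤ (suc (N * Φ)) (^-monoʳ-≤ p r≤k)) ⟩
      (p ℕ.^ k) ℕ.^ N * (p ℕ.^ k * suc (N * Φ))          ≤⟨ growth N N≥ ⟩
      (512 ℕ.^ k * length B) ℕ.^ N                       ≡⟨ [a*b]^n≡a^n*b^n (512 ℕ.^ k) (length B) N ⟩
      (512 ℕ.^ k) ℕ.^ N * length B ℕ.^ N                 ≤⟨ *-monoʳ-≤ ((512 ℕ.^ k) ℕ.^ N) le ⟩
      (512 ℕ.^ k) ℕ.^ N * (suc (N * Φ) * length A)       ≤⟨ *-monoˡ-≤ _ (m≤m*n ((512 ℕ.^ k) ℕ.^ N) (512 ℕ.^ r) {{m^n≢0 512 r}}) ⟩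
      (512 ℕ.^ k) ℕ.^ N * 512 ℕ.^ r * (suc (N * Φ) * length A) ≡⟨ cong (_* (suc (N * Φ) * length A)) (split 512) ⟨
      512 ℕ.^ n * (suc (N * Φ) * length A)               ≡⟨ rearrange (512 ℕ.^ n) (suc (N * Φ)) (length A) ⟩
      512 ℕ.^ n * length A * suc (N * Φ)                 ∎

hasLargeSets : ∀ {m k} .{{_ : NonZero m}} .{{_ : NonZero k}} {B : List (ℤmod^ m k)} {φ : ℤmod^ m k → ℕ} →
  Unique B → StrictlyConvexOn B φ → (257 * m) ℕ.^ k < length B * 512 ℕ.^ k →
  HasLargeSets m
hasLargeSets {B = B} {φ} = bounded⇒hasLargeSets (max 0 (List.map φ B))
  λ x∈B → All.lookup (xs≤max 0 (List.map φ B)) (∈-map⁺ φ x∈B)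

-- Progressions modulo m as congruences in ℕ

-- Congruence modulo m for a, b < 2m.
Congruent : ℕ → ℕ → ℕ → Set
Congruent m a b = a ≡ b ⊎ a ≡ b + m ⊎ a + m ≡ b

-- Here u is the reduction of b. Moving u across gives x + z - b = (q - 1 - d) m, and the size
-- bounds leave only q = 1, 2 and d = 0, 1.
reduced⇒congruent : ∀ {m u x z b} q d → u < m → x < m → z < m → b < 2 * m →
  x + (m ∸ u) + z ≡ q * m → b ≡ u + d * m → Congruent m (x + z) b
reduced⇒congruent {m} {u} {x} {z} {b} q d u<m x<m z<m b<2m sum≡ b≡ = go q d total b≡
  where
  open ≤-Reasoning
  regroup : ∀ x v z u → x + v + z + u ≡ x + z + (v + u)
  regroup = solve-∀
  total : x + z + m ≡ u + q * m
  total = begin-equality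
    x + z + m              ≡⟨ cong (x + z +_) (m∸n+n≡m (<⇒≤ u<m)) ⟨
    x + z + ((m ∸ u) + u)  ≡⟨ regroup x (m ∸ u) z u ⟨
    x + (m ∸ u) + z + u    ≡⟨ cong (_+ u) sum≡ ⟩
    q * m + u              ≡⟨ +-comm (q * m) u ⟩
    u + q * m              ∎
  triple : ∀ m → m + m + m ≡ 3 * m
  triple = solve-∀
  split : ∀ u m → u + 2 * m ≡ u + m + m
  split = solve-∀
  go : ∀ q d → x + z + m ≡ u + q * m → b ≡ u + d * m → Congruent m (x + z) b
  go 0 d eq _ = contradiction u<m (≤⇒≯ (begin
    m          ≤⟨ m≤n+m m (x + z) ⟩
    x + z + m  ≡⟨ eq ⟩
    u + 0      ≡⟨ +-identityʳ u ⟩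
    u          ∎))
  go (suc (suc (suc q))) d eq _ = contradiction (+-monoˡ-< m (+-mono-< x<m z<m)) (≤⇒≯ (begin
    m + m + m            ≡⟨ triple m ⟩
    3 * m                ≤⟨ *-monoˡ-≤ m (m≤m+n 3 q) ⟩
    (3 + q) * m          ≤⟨ m≤n+m ((3 + q) * m) u ⟩
    u + (3 + q) * m      ≡⟨ eq ⟨
    x + z + m            ∎))
  go q (suc (suc d)) _ b≡ = contradiction b<2m (≤⇒≯ (begin
    2 * m            ≤⟨ *-monoˡ-≤ m (m≤m+n 2 d) ⟩
    (2 + d) * m      ≤⟨ m≤n+m ((2 + d) * m) u ⟩
    u + (2 + d) * m  ≡⟨ b≡ ⟨
    b                ∎))
  go 1 0 eq b≡ = inj₁ (trans (+-cancelʳ-≡ m (x + z) u (trans eq (cong (u +_) (+-identityʳ m)))) (trans (sym (+-identityʳ u)) (sym b≡)))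
  go 1 1 eq b≡ = inj₂ (inj₂ (trans eq (sym b≡)))
  go 2 0 eq b≡ = inj₂ (inj₁ (trans (+-cancelʳ-≡ m (x + z) (u + m) (trans eq (split u m))) (cong (_+ m) (trans (sym (+-identityʳ u)) (sym b≡)))))
  go 2 1 eq b≡ = inj₁ (trans (+-cancelʳ-≡ m (x + z) (u + m) (trans eq (split u m))) (trans (cong (u +_) (sym (+-identityʳ m))) (sym b≡)))

AP⇒congruent : ∀ {m} .{{_ : NonZero m}} (x y z : ℤmod m) → x -ₘ 2 ·ₘ y +ₘ z ≡ 0ₘ →
  Congruent m (toℕ x + toℕ z) (2 * toℕ y)
AP⇒congruent {m@(suc _)} x y z eq =
  reduced⇒congruent (quotient m∣sum) (2 * toℕ y / m)
    (toℕ<n (2 ·ₘ y)) (toℕ<n x) (toℕ<n z) (*-monoʳ-< 2 (toℕ<n y)) (m∣n⇒n≡quotient*m m∣sum)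
    (trans (m≡m%n+[m/n]*n (2 * toℕ y) m) (cong (_+ 2 * toℕ y / m * m) (sym (toℕ-mod (2 * toℕ y)))))
  where
  open ≡-Reasoning
  toℕ-mod : ∀ a → toℕ (a mod m) ≡ a % m
  toℕ-mod a = toℕ-fromℕ< (m%n<n a m)
  p = toℕ x + (m ∸ toℕ (2 ·ₘ y))
  -- `_+ₘ_` receives p already reduced; the chain shows that this inner reduction does not change
  -- the total modulo m.
  sum%m≡0 : (p + toℕ z) % m ≡ 0
  sum%m≡0 = begin
    (p + toℕ z) % m               ≡⟨ %-distribˡ-+ p (toℕ z) m ⟩
    (p % m + toℕ z % m) % m       ≡⟨ cong (λ w → (w + toℕ z % m) % m) (m%n%n≡m%n p m) ⟨
    (p % m % m + toℕ z % m) % m   ≡⟨ %-distribˡ-+ (p % m) (toℕ z) m ⟨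
    (p % m + toℕ z) % m           ≡⟨ cong (λ w → (w + toℕ z) % m) (toℕ-mod p) ⟨
    (toℕ (p mod m) + toℕ z) % m   ≡⟨ toℕ-mod (toℕ (p mod m) + toℕ z) ⟨
    toℕ (x -ₘ 2 ·ₘ y +ₘ z)        ≡⟨ cong toℕ eq ⟩
    toℕ (0ₘ {m})                  ≡⟨⟩
    0                             ∎
  m∣sum : m ∣ p + toℕ z
  m∣sum = m%n≡0⇒n∣m (p + toℕ z) m sum%m≡0

-- Convexity of squares

-- The parallelogram identity. The term `∣ a - c ∣` squared is the source of strictness at a
-- midpoint.
2[a²+c²]≡[a+c]²+∣a-c∣² : ∀ a c → 2 * (a * a + c * c) ≡ (a + c) * (a + c) + ∣ a - c ∣ * ∣ a - c ∣
2[a²+c²]≡[a+c]²+∣a-c∣² a c with ≤-total a c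
... | inj₁ a≤c with d , refl ← m≤n⇒∃[o]m+o≡n a≤c rewrite ∣m-m+n∣≡n a d = lemma a d
  where
  lemma : ∀ a d → 2 * (a * a + (a + d) * (a + d)) ≡ (a + (a + d)) * (a + (a + d)) + d * d
  lemma = solve-∀
... | inj₂ c≤a with d , refl ← m≤n⇒∃[o]m+o≡n c≤a rewrite ∣-∣-comm (c + d) c | ∣m-m+n∣≡n c d = lemma c d
  where
  lemma : ∀ c d → 2 * ((c + d) * (c + d) + c * c) ≡ (c + d + c) * (c + d + c) + d * d
  lemma = solve-∀

midpoint²< : ∀ {a b c} → a ≢ c → a + c ≡ 2 * b → 2 * (b * b) < a * a + c * c
midpoint²< {a} {b} {c} a≢c eq = *-cancelˡ-< 2 _ _ (begin-strict
  2 * (2 * (b * b))                              ≡⟨ lemma b ⟩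
  2 * b * (2 * b)                                ≡⟨ cong (λ s → s * s) eq ⟨
  (a + c) * (a + c)                              <⟨ m<m+n _ (>-nonZero⁻¹ (d * d) {{m*n≢0 d d}}) ⟩
  (a + c) * (a + c) + d * d                      ≡⟨ 2[a²+c²]≡[a+c]²+∣a-c∣² a c ⟨
  2 * (a * a + c * c)                            ∎)
  where
  open ≤-Reasoning
  d = ∣ a - c ∣
  instance _ = ≢-nonZero {d} (a≢c ∘ ∣m-n∣≡0⇒m≡n)
  lemma : ∀ b → 2 * (2 * (b * b)) ≡ 2 * b * (2 * b)
  lemma = solve-∀

-- For the wraps s₁ + s₃ = 2s₂ + m: the mean of the outer terms lies above the middle term, and
-- squaring is increasing on ℕ.
2b<a+c⇒2b²<a²+c² : ∀ {a b c} → 2 * b < a + c → 2 * (b * b) < a * a + c * c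
2b<a+c⇒2b²<a²+c² {a} {b} {c} lt = *-cancelˡ-< 2 _ _ (begin-strict
  2 * (2 * (b * b))                              ≡⟨ lemma b ⟩
  2 * b * (2 * b)                                <⟨ *-mono-< lt lt ⟩
  (a + c) * (a + c)                              ≤⟨ m≤m+n _ _ ⟩
  (a + c) * (a + c) + ∣ a - c ∣ * ∣ a - c ∣      ≡⟨ 2[a²+c²]≡[a+c]²+∣a-c∣² a c ⟨
  2 * (a * a + c * c)                            ∎)
  where
  open ≤-Reasoning
  lemma : ∀ b → 2 * (2 * (b * b)) ≡ 2 * b * (2 * b)
  lemma = solve-∀

-- The half interval for small moduli

-- For even m and h = m/2 there is the degenerate progression (0 , h , 0), hence the need for
-- equal values at 0 and h.
half-bowl : ℕ → ℕ → ℕ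
half-bowl h i = i * i + (h ∸ i) * (h ∸ i)

-- Without a wrap, both parabolas are strictly convex. A wrap can only involve the ends of the
-- interval, where the values agree.
half-bowl-convex : ∀ {m h a b c} → 2 * h ≤ m → a ≤ h → b ≤ h → c ≤ h → Congruent m (a + c) (2 * b) →
  (a ≡ c × half-bowl h a ≡ half-bowl h b) ⊎ 2 * half-bowl h b < half-bowl h a + half-bowl h c
half-bowl-convex {m} {h} {a} {b} {c} 2h≤m a≤h b≤h c≤h (inj₁ eq) with a ≟ c
... | yes refl = inj₁ (refl , cong (half-bowl h) (*-cancelˡ-≡ a b 2 (trans (cong (a +_) (+-identityʳ a)) eq)))
... | no a≢c   = inj₂ (begin-strict
  2 * half-bowl h b                                          ≡⟨ *-distribˡ-+ 2 (b * b) _ ⟩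
  2 * (b * b) + 2 * ((h ∸ b) * (h ∸ b))                      <⟨ +-mono-< (midpoint²< {b = b} a≢c eq) (midpoint²< {b = h ∸ b} (a≢c ∘ ∸-cancelˡ-≡ a≤h c≤h) eq′) ⟩
  (a * a + c * c) + ((h ∸ a) * (h ∸ a) + (h ∸ c) * (h ∸ c))  ≡⟨ regroup (a * a) (c * c) _ _ ⟩
  half-bowl h a + half-bowl h c                              ∎)
  where
  open ≤-Reasoning
  regroup : ∀ x y z w → (x + y) + (z + w) ≡ (x + z) + (y + w)
  regroup = solve-∀
  eq′ : (h ∸ a) + (h ∸ c) ≡ 2 * (h ∸ b)
  eq′ = +-cancelˡ-≡ (a + c) _ _ (begin-equality
    a + c + ((h ∸ a) + (h ∸ c))   ≡⟨ regroup a c _ _ ⟩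
    (a + (h ∸ a)) + (c + (h ∸ c)) ≡⟨ cong₂ _+_ (m+[n∸m]≡n a≤h) (m+[n∸m]≡n c≤h) ⟩
    h + h                         ≡⟨ cong (h +_) (+-identityʳ h) ⟨
    2 * h                         ≡⟨ cong (2 *_) (m+[n∸m]≡n b≤h) ⟨
    2 * (b + (h ∸ b))             ≡⟨ *-distribˡ-+ 2 b (h ∸ b) ⟩
    2 * b + 2 * (h ∸ b)           ≡⟨ cong (_+ 2 * (h ∸ b)) eq ⟨
    a + c + 2 * (h ∸ b)           ∎)
-- Here a + c ≥ m ≥ 2h forces a = c = h and b = 0.
half-bowl-convex {m} {h} {a} {b} {c} 2h≤m a≤h b≤h c≤h (inj₂ (inj₁ eq)) =
  inj₁ (trans a≡h (sym c≡h) , trans (cong (half-bowl h) a≡h) (trans ends (cong (half-bowl h) (sym b≡0))))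
  where
  open ≤-Reasoning
  total : h + h ≤ a + c
  total = begin
    h + h      ≡⟨ cong (h +_) (+-identityʳ h) ⟨
    2 * h      ≤⟨ 2h≤m ⟩
    m          ≤⟨ m≤n+m m (2 * b) ⟩
    2 * b + m  ≡⟨ eq ⟨
    a + c      ∎
  a≡h : a ≡ h
  a≡h = ≤-antisym a≤h (+-cancelʳ-≤ h h a (≤-trans total (+-monoʳ-≤ a c≤h)))
  c≡h : c ≡ h
  c≡h = ≤-antisym c≤h (+-cancelˡ-≤ h h c (≤-trans total (+-monoˡ-≤ c a≤h)))
  b≡0 : b ≡ 0
  b≡0 = *-cancelˡ-≡ b 0 2 (n≤0⇒n≡0 (+-cancelʳ-≤ m (2 * b) 0 (begin
    2 * b + m  ≡⟨ eq ⟨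
    a + c      ≤⟨ +-mono-≤ a≤h c≤h ⟩
    h + h      ≡⟨ cong (h +_) (+-identityʳ h) ⟨
    2 * h      ≤⟨ 2h≤m ⟩
    m          ∎)))
  ends : half-bowl h h ≡ half-bowl h 0
  ends rewrite n∸n≡0 h = +-identityʳ (h * h)
-- Here 2b ≥ m ≥ 2h forces b = h and a = c = 0.
half-bowl-convex {m} {h} {a} {b} {c} 2h≤m a≤h b≤h c≤h (inj₂ (inj₂ eq)) =
  inj₁ (trans a≡0 (sym c≡0) , trans (cong (half-bowl h) a≡0) (trans ends (cong (half-bowl h) (sym b≡h))))
  where
  open ≤-Reasoning
  2b≤m : 2 * b ≤ m
  2b≤m = ≤-trans (*-monoʳ-≤ 2 b≤h) 2h≤m
  a+c≡0 : a + c ≡ 0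
  a+c≡0 = n≤0⇒n≡0 (+-cancelʳ-≤ m (a + c) 0 (≤-trans (≤-reflexive eq) 2b≤m))
  a≡0 : a ≡ 0
  a≡0 = m+n≡0⇒m≡0 a a+c≡0
  c≡0 : c ≡ 0
  c≡0 = m+n≡0⇒n≡0 a a+c≡0
  b≡h : b ≡ h
  b≡h = ≤-antisym b≤h (*-cancelˡ-≤ 2 (begin
    2 * h      ≤⟨ 2h≤m ⟩
    m          ≤⟨ m≤n+m m (a + c) ⟩
    a + c + m  ≡⟨ eq ⟩
    2 * b      ∎))
  ends : half-bowl h 0 ≡ half-bowl h h
  ends rewrite n∸n≡0 h = sym (+-identityʳ (h * h))

module HalfInterval (m : ℕ) .{{_ : NonZero m}} (m≥2 : m ≥ 2) where

  h : ℕ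
  h = m / 2

  2h≤m : 2 * h ≤ m
  2h≤m = ≤-trans (≤-reflexive (*-comm 2 h)) (m/n*n≤m m 2)

  h<m : h < m
  h<m = m/n<m m 2 (s≤s (s≤s z≤n))

  digit : Fin (suc h) → ℤmod m
  digit i = inject≤ i h<m

  block : List (ℤmod^ m 1)
  block = List.map (λ i → digit i ∷ []) (allFin (suc h))

  block! : Unique block
  block! = Unique.map⁺ (inject≤-injective h<m h<m _ _ ∘ Vec.∷-injectiveˡ) (Unique.allFin⁺ (suc h))

  φ : ℤmod^ m 1 → ℕ
  φ (x ∷ []) = half-bowl h (toℕ x)

  convex : StrictlyConvexOn block φ
  convex x∈ y∈ z∈ eq
    with i , _ , refl ← ∈-map⁻ (λ i → digit i ∷ []) x∈
       | j , _ , refl ← ∈-map⁻ (λ i → digit i ∷ []) y∈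
       | k , _ , refl ← ∈-map⁻ (λ i → digit i ∷ []) z∈
    with half-bowl-convex 2h≤m (bound i) (bound j) (bound k) (AP⇒congruent (digit i) (digit j) (digit k) (Vec.∷-injectiveˡ eq))
    where
    bound : ∀ i → toℕ (digit i) ≤ h
    bound i = ≤-trans (≤-reflexive (toℕ-inject≤ i h<m)) (s≤s⁻¹ (toℕ<n i))
  ... | inj₁ (x≡z , φx≡φy) = inj₁ (cong (_∷ []) (toℕ-injective x≡z) , φx≡φy)
  ... | inj₂ lt            = inj₂ lt

  length-block : length block ≡ suc h
  length-block = trans (length-map (λ i → digit i ∷ []) (allFin (suc h))) (length-tabulate id)

  -- The block has at least (m + 1) / 2 points, and 257 m < 256 (m + 1) exactly when m < 256.
  dense : m < 256 → (257 * m) ℕ.^ 1 < length block * 512 ℕ.^ 1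
  dense m<256 = begin-strict
    257 * m * 1                ≡⟨ lemma m ⟩
    m + 256 * m                <⟨ +-monoˡ-< (256 * m) m<256 ⟩
    256 + 256 * m              ≡⟨ *-suc 256 m ⟨
    256 * suc m                ≤⟨ *-monoʳ-≤ 256 m<2[1+h] ⟩
    256 * (2 * suc h)          ≡⟨ *-assoc 256 2 (suc h) ⟨
    512 * suc h                ≡⟨ cong (512 *_) length-block ⟨
    512 * length block         ≡⟨ *-comm 512 (length block) ⟩
    length block * 512         ∎
    where
    open ≤-Reasoning
    lemma : ∀ m → 257 * m * 1 ≡ m + 256 * m
    lemma = solve-∀
    m<2[1+h] : m < 2 * suc h
    m<2[1+h] = begin-strict
      m                ≡⟨ m≡m%n+[m/n]*n m 2 ⟩
      m % 2 + h * 2    <⟨ +-monoˡ-< (h * 2) (m%n<n m 2) ⟩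
      2 + h * 2        ≡⟨ *-comm (suc h) 2 ⟩
      2 * suc h        ∎

-- The 18 cells and their finite checks

Cell : Set
Cell = Fin 8 × Fin 8

-- The cell (i , j) stands for the product of the intervals [i/8, (i+1)/8) and [j/8, (j+1)/8)
-- of the circle.
cells : List Cell
cells =
  (# 0 , # 0) ∷ (# 0 , # 1) ∷
  (# 1 , # 0) ∷ (# 1 , # 1) ∷
  (# 2 , # 0) ∷ (# 2 , # 1) ∷ (# 2 , # 2) ∷ (# 2 , # 3) ∷
  (# 3 , # 0) ∷ (# 3 , # 1) ∷ (# 3 , # 2) ∷ (# 3 , # 3) ∷
  (# 4 , # 2) ∷ (# 4 , # 3) ∷ (# 4 , # 6) ∷ (# 4 , # 7) ∷
  (# 5 , # 3) ∷ (# 5 , # 7) ∷ []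

cells! : Unique cells
cells! = from-yes (DecUnique.unique? (Product.≡-dec Fin._≟_ Fin._≟_) cells)

-- Sums of two residues whose cell indices add up to I and to J can only be equal if
-- I and J differ by at most 1.
Near : ℕ → ℕ → Set
Near I J = I < 2 + J × J < 2 + I

NearMod : ℕ → ℕ → Set
NearMod I J = Near I J ⊎ Near I (J + 8) ⊎ Near (I + 8) J

near? : ∀ I J → Dec (Near I J)
near? I J = (I <? 2 + J) ×-dec (J <? 2 + I)

nearMod? : ∀ I J → Dec (NearMod I J)
nearMod? I J = near? I J ⊎-dec near? I (J + 8) ⊎-dec near? (I + 8) J

-- The multiple of m that brings 2t into [m, 2m): 1 for t in the lower half of the circle, 0 for the
-- upper half. Adding m below instead of subtracting it above avoids truncated subtraction.
lower : ℕ → ℕ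
lower j with j <? 4
... | yes _ = 1
... | no _  = 0

NoBackwardWrap : Cell → Cell → Cell → Set
NoBackwardWrap (i₁ , j₁) (i₂ , j₂) (i₃ , j₃) =
  ¬ (Near (toℕ i₁ + toℕ i₃ + 8) (2 * toℕ i₂) × NearMod (toℕ j₁ + toℕ j₃) (2 * toℕ j₂))

-- Decided over all triples of cells. A backward wrap needs i₂ = 4 with i₁ + i₃ ≤ 1, or i₂ = 5 with
-- i₁ + i₃ ≤ 3. Then j₁ + j₃ is at most 2, respectively 4, and keeps distance at least 2 modulo 8
-- from 2j₂, which is 4 or 6, respectively 6.
noBackwardWrap : All (λ x → All (λ y → All (NoBackwardWrap x y) cells) cells) cells
noBackwardWrap = from-yes (all? (λ (i₁ , j₁) → all? (λ (i₂ , j₂) → all? (λ (i₃ , j₃) →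
  ¬? (near? (toℕ i₁ + toℕ i₃ + 8) (2 * toℕ i₂) ×-dec nearMod? (toℕ j₁ + toℕ j₃) (2 * toℕ j₂))) cells) cells) cells)

-- If l₁ = l₃ and t₁ + t₃ = 2t₂ + e m, the representatives 2t + l m form an exact progression in ℕ
-- if and only if l₂ = l₁ + e. The three implications treat e = 0, 1, -1.
Aligned : ℕ → ℕ → ℕ → Set
Aligned J₁ J₂ J₃ = lower J₁ ≡ lower J₃ ×
  (Near (J₁ + J₃) (2 * J₂) → lower J₂ ≡ lower J₁) ×
  (Near (J₁ + J₃) (2 * J₂ + 8) → lower J₂ ≡ suc (lower J₁)) ×
  (Near (J₁ + J₃ + 8) (2 * J₂) → suc (lower J₂) ≡ lower J₁)

aligned? : ∀ J₁ J₂ J₃ → Dec (Aligned J₁ J₂ J₃)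
aligned? J₁ J₂ J₃ = (lower J₁ ≟ lower J₃) ×-dec
  (near? (J₁ + J₃) (2 * J₂) →-dec (lower J₂ ≟ lower J₁)) ×-dec
  (near? (J₁ + J₃) (2 * J₂ + 8) →-dec (lower J₂ ≟ suc (lower J₁))) ×-dec
  (near? (J₁ + J₃ + 8) (2 * J₂) →-dec (suc (lower J₂) ≟ lower J₁))

RowAligned : Cell → Cell → Cell → Set
RowAligned (i₁ , j₁) (i₂ , j₂) (i₃ , j₃) = i₁ ≡ i₂ → i₃ ≡ i₂ →
  NearMod (toℕ j₁ + toℕ j₃) (2 * toℕ j₂) → Aligned (toℕ j₁) (toℕ j₂) (toℕ j₃)

-- In rows 0 to 3 all t lie in the lower half and no wrap occurs. Rows 4 and 5 contain j together
-- with j + 4, but there the sum of a lower and an upper cell is never near a double modulo 8, so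
-- the outer terms share a half.
rowAligned : All (λ x → All (λ y → All (RowAligned x y) cells) cells) cells
rowAligned = from-yes (all? (λ (i₁ , j₁) → all? (λ (i₂ , j₂) → all? (λ (i₃ , j₃) →
  (i₁ Fin.≟ i₂) →-dec (i₃ Fin.≟ i₂) →-dec nearMod? (toℕ j₁ + toℕ j₃) (2 * toℕ j₂) →-dec
    aligned? (toℕ j₁) (toℕ j₂) (toℕ j₃)) cells) cells) cells)

-- The quadratic potential

doubled-midpoint : ∀ m t₁ t₂ t₃ {l₁ l₂ l₃} → l₁ ≡ l₃ →
  (t₁ + t₃ ≡ 2 * t₂ × l₂ ≡ l₁) ⊎ (t₁ + t₃ ≡ 2 * t₂ + m × l₂ ≡ suc l₁) ⊎ (t₁ + t₃ + m ≡ 2 * t₂ × suc l₂ ≡ l₁) →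
  (2 * t₁ + l₁ * m) + (2 * t₃ + l₃ * m) ≡ 2 * (2 * t₂ + l₂ * m)
doubled-midpoint m t₁ t₂ t₃ {l} refl cases = trans (collect t₁ t₃ l m) (cong (2 *_) (go cases))
  where
  collect : ∀ x z l m → (2 * x + l * m) + (2 * z + l * m) ≡ 2 * (x + z + l * m)
  collect = solve-∀
  go : ∀ {l₁ l₂} → (t₁ + t₃ ≡ 2 * t₂ × l₂ ≡ l₁) ⊎ (t₁ + t₃ ≡ 2 * t₂ + m × l₂ ≡ suc l₁) ⊎ (t₁ + t₃ + m ≡ 2 * t₂ × suc l₂ ≡ l₁) →
    t₁ + t₃ + l₁ * m ≡ 2 * t₂ + l₂ * m
  go {l₁} (inj₁ (eq , refl)) = cong (_+ l₁ * m) eq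
  go {l₁} (inj₂ (inj₁ (eq , refl))) = trans (cong (_+ l₁ * m) eq) (+-assoc (2 * t₂) m (l₁ * m))
  go {l₂ = l₂} (inj₂ (inj₂ (eq , refl))) = trans (sym (+-assoc (t₁ + t₃) m (l₂ * m))) (cong (_+ l₂ * m) eq)

potential : ℕ → ℕ → ℕ → ℕ
potential w s d = w * (s * s) + d * d

-- A strict inequality of integers has a gap of at least 1; multiplied by w, the gap outweighs
-- `2 * (d₂ * d₂)`.
potential-strict₁ : ∀ w s₁ s₂ s₃ d₁ d₂ d₃ → 2 * (d₂ * d₂) < w → 2 * (s₂ * s₂) < s₁ * s₁ + s₃ * s₃ →
  2 * potential w s₂ d₂ < potential w s₁ d₁ + potential w s₃ d₃
potential-strict₁ w s₁ s₂ s₃ d₁ d₂ d₃ d₂-small lt = begin-strict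
  2 * (w * (s₂ * s₂) + d₂ * d₂)                            ≡⟨ lemma w (s₂ * s₂) (d₂ * d₂) ⟩
  w * (2 * (s₂ * s₂)) + 2 * (d₂ * d₂)                      <⟨ +-monoʳ-< (w * (2 * (s₂ * s₂))) d₂-small ⟩
  w * (2 * (s₂ * s₂)) + w                                  ≡⟨ +-comm _ w ⟩
  w + w * (2 * (s₂ * s₂))                                  ≡⟨ *-suc w _ ⟨
  w * suc (2 * (s₂ * s₂))                                  ≤⟨ *-monoʳ-≤ w lt ⟩
  w * (s₁ * s₁ + s₃ * s₃)                                  ≤⟨ m≤m+n _ (d₁ * d₁ + d₃ * d₃) ⟩
  w * (s₁ * s₁ + s₃ * s₃) + (d₁ * d₁ + d₃ * d₃)            ≡⟨ lemma′ w (s₁ * s₁) (s₃ * s₃) (d₁ * d₁) (d₃ * d₃) ⟩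
  (w * (s₁ * s₁) + d₁ * d₁) + (w * (s₃ * s₃) + d₃ * d₃)    ∎
  where
  open ≤-Reasoning
  lemma : ∀ w x d → 2 * (w * x + d) ≡ w * (2 * x) + 2 * d
  lemma = solve-∀
  lemma′ : ∀ w x z d e → w * (x + z) + (d + e) ≡ (w * x + d) + (w * z + e)
  lemma′ = solve-∀

potential-strict₂ : ∀ w s d₁ d₂ d₃ → d₁ ≢ d₃ → d₁ + d₃ ≡ 2 * d₂ →
  2 * potential w s d₂ < potential w s d₁ + potential w s d₃
potential-strict₂ w s d₁ d₂ d₃ d₁≢d₃ mid =
  subst₂ _<_ (lemma (w * (s * s)) (d₂ * d₂)) (lemma′ (w * (s * s)) (d₁ * d₁) (d₃ * d₃))
    (+-monoʳ-< (2 * (w * (s * s))) (midpoint²< {b = d₂} d₁≢d₃ mid))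
  where
  lemma : ∀ x d → 2 * x + 2 * d ≡ 2 * (x + d)
  lemma = solve-∀
  lemma′ : ∀ x d e → 2 * x + (d + e) ≡ (x + d) + (x + e)
  lemma′ = solve-∀

-- Squaring `b * m ≤ c * q` replaces m² by a multiple of q², and then only constants are compared.
scaled-squares-< : ∀ a b c e k m q .{{_ : NonZero b}} .{{_ : NonZero q}} →
  b * m ≤ c * q → a * a * (c * c) < b * b * (e * e * k) → (a * m) ℕ.^ 2 < k * (q * q) * e ℕ.^ 2
scaled-squares-< a b c e k m q bm≤cq lt = *-cancelˡ-< (b * b) _ _ (begin-strict
  b * b * (a * m * (a * m * 1))        ≡⟨ lemma a b m ⟩
  a * a * (b * m * (b * m))            ≤⟨ *-monoʳ-≤ (a * a) (*-mono-≤ bm≤cq bm≤cq) ⟩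
  a * a * (c * q * (c * q))            ≡⟨ lemma′ a c q ⟩
  a * a * (c * c) * (q * q)            <⟨ *-monoˡ-< (q * q) {{m*n≢0 q q}} lt ⟩
  b * b * (e * e * k) * (q * q)        ≡⟨ lemma″ b e k q ⟩
  b * b * (k * (q * q) * (e * (e * 1))) ∎)
  where
  open ≤-Reasoning
  lemma : ∀ a b m → b * b * (a * m * (a * m * 1)) ≡ a * a * (b * m * (b * m))
  lemma = solve-∀
  lemma′ : ∀ a c q → a * a * (c * q * (c * q)) ≡ a * a * (c * c) * (q * q)
  lemma′ = solve-∀
  lemma″ : ∀ b e k q → b * b * (e * e * k) * (q * q) ≡ b * b * (k * (q * q) * (e * (e * 1)))
  lemma″ = solve-∀

-- Strict convexity on the union of the cells

module CellSet (m : ℕ) .{{_ : NonZero m}} where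

  index : ℕ → ℕ
  index x = 8 * x / m

  -- The range of a sum of two residues whose indices add up to I: each contributes an interval of
  -- length m/8, hence the width 2.
  record Within (a I : ℕ) : Set where
    constructor within
    field
      lo : m * I ≤ 8 * a
      hi : 8 * a < m * (2 + I)
  open Within

  index-lo : ∀ x → m * index x ≤ 8 * x
  index-lo x = ≤-trans (≤-reflexive (*-comm m (index x))) (m/n*n≤m (8 * x) m)

  index-hi : ∀ x → 8 * x < m * suc (index x)
  index-hi x = begin-strict
    8 * x                          ≡⟨ m≡m%n+[m/n]*n (8 * x) m ⟩
    8 * x % m + index x * m        <⟨ +-monoˡ-< (index x * m) (m%n<n (8 * x) m) ⟩
    m + index x * m                ≡⟨ *-comm (suc (index x)) m ⟩
    m * suc (index x)              ∎
    where open ≤-Reasoning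

  index-unique : ∀ {x i} → m * i ≤ 8 * x → 8 * x < m * suc i → index x ≡ i
  index-unique {x} {i} mi≤ <m[1+i] = ≤-antisym
    (s≤s⁻¹ (*-cancelˡ-< m _ _ (≤-<-trans (index-lo x) <m[1+i])))
    (s≤s⁻¹ (*-cancelˡ-< m _ _ (≤-<-trans mi≤ (index-hi x))))

  within-+ : ∀ x z → Within (x + z) (index x + index z)
  lo (within-+ x z) = begin
    m * (index x + index z)        ≡⟨ *-distribˡ-+ m (index x) (index z) ⟩
    m * index x + m * index z      ≤⟨ +-mono-≤ (index-lo x) (index-lo z) ⟩
    8 * x + 8 * z                  ≡⟨ *-distribˡ-+ 8 x z ⟨
    8 * (x + z)                    ∎
    where open ≤-Reasoning
  hi (within-+ x z) = begin-strict
    8 * (x + z)                              ≡⟨ *-distribˡ-+ 8 x z ⟩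
    8 * x + 8 * z                            <⟨ +-mono-< (index-hi x) (index-hi z) ⟩
    m * suc (index x) + m * suc (index z)    ≡⟨ *-distribˡ-+ m (suc (index x)) (suc (index z)) ⟨
    m * (suc (index x) + suc (index z))      ≡⟨ cong (λ I → m * suc I) (+-suc (index x) (index z)) ⟩
    m * (2 + (index x + index z))            ∎
    where open ≤-Reasoning

  within-double : ∀ x → Within (2 * x) (2 * index x)
  within-double x = subst₂ Within (cong (x +_) (sym (+-identityʳ x))) (cong (index x +_) (sym (+-identityʳ (index x)))) (within-+ x x)

  within-wrap : ∀ {a I} → Within a I → Within (a + m) (I + 8)
  lo (within-wrap {a} {I} w) = begin
    m * (I + 8)        ≡⟨ lemma m I ⟩
    m * I + 8 * m      ≤⟨ +-monoˡ-≤ (8 * m) (lo w) ⟩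
    8 * a + 8 * m      ≡⟨ *-distribˡ-+ 8 a m ⟨
    8 * (a + m)        ∎
    where
    open ≤-Reasoning
    lemma : ∀ m I → m * (I + 8) ≡ m * I + 8 * m
    lemma = solve-∀
  hi (within-wrap {a} {I} w) = begin-strict
    8 * (a + m)              ≡⟨ *-distribˡ-+ 8 a m ⟩
    8 * a + 8 * m            <⟨ +-monoˡ-< (8 * m) (hi w) ⟩
    m * (2 + I) + 8 * m      ≡⟨ lemma m I ⟩
    m * (2 + (I + 8))        ∎
    where
    open ≤-Reasoning
    lemma : ∀ m I → m * (2 + I) + 8 * m ≡ m * (2 + (I + 8))
    lemma = solve-∀

  -- Two half-open intervals of length 2 with a common point have starting points less than 2 apart.
  within⇒near : ∀ {a I J} → Within a I → Within a J → Near I J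
  within⇒near w w′ = *-cancelˡ-< m _ _ (≤-<-trans (lo w) (hi w′)) , *-cancelˡ-< m _ _ (≤-<-trans (lo w′) (hi w))

  near-≡ : ∀ x y z → x + z ≡ 2 * y → Near (index x + index z) (2 * index y)
  near-≡ x y z eq = within⇒near (within-+ x z) (subst (λ a → Within a (2 * index y)) (sym eq) (within-double y))

  near-forward : ∀ x y z → x + z ≡ 2 * y + m → Near (index x + index z) (2 * index y + 8)
  near-forward x y z eq = within⇒near (within-+ x z) (subst (λ a → Within a (2 * index y + 8)) (sym eq) (within-wrap (within-double y)))

  near-backward : ∀ x y z → x + z + m ≡ 2 * y → Near (index x + index z + 8) (2 * index y)
  near-backward x y z eq = within⇒near (within-wrap (within-+ x z)) (subst (λ a → Within a (2 * index y)) (sym eq) (within-double y))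

  congruent⇒nearMod : ∀ x y z → Congruent m (x + z) (2 * y) → NearMod (index x + index z) (2 * index y)
  congruent⇒nearMod x y z (inj₁ eq)        = inj₁ (near-≡ x y z eq)
  congruent⇒nearMod x y z (inj₂ (inj₁ eq)) = inj₂ (inj₁ (near-forward x y z eq))
  congruent⇒nearMod x y z (inj₂ (inj₂ eq)) = inj₂ (inj₂ (near-backward x y z eq))

  -- The representative of 2t modulo m in [m, 2m).
  doubled : ℕ → ℕ
  doubled t = 2 * t + lower (index t) * m

  -- The weight 18m² is 2 (3m)², and `doubled t` stays below 3m, so a gap in s² dominates every
  -- difference in t.
  φ : ℕ → ℕ → ℕ
  φ s t = potential (18 * (m * m)) s (doubled t)

  InCell : ℕ → ℕ → Cell → Set
  InCell s t (i , j) = index s ≡ toℕ i × index t ≡ toℕ j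

  lower≤1 : ∀ j → lower j ≤ 1
  lower≤1 j with j <? 4
  ... | yes _ = s≤s z≤n
  ... | no _  = z≤n

  2*doubled²<18m² : ∀ t → t < m → 2 * (doubled t * doubled t) < 18 * (m * m)
  2*doubled²<18m² t t<m = begin-strict
    2 * (doubled t * doubled t)      <⟨ *-monoʳ-< 2 (*-mono-< doubled<3m doubled<3m) ⟩
    2 * (3 * m * (3 * m))            ≡⟨ lemma m ⟩
    18 * (m * m)                     ∎
    where
    open ≤-Reasoning
    lemma : ∀ m → 2 * (3 * m * (3 * m)) ≡ 18 * (m * m)
    lemma = solve-∀
    lemma′ : ∀ m → 2 * m + 1 * m ≡ 3 * m
    lemma′ = solve-∀
    doubled<3m : doubled t < 3 * m
    doubled<3m = begin-strict
      2 * t + lower (index t) * m    <⟨ +-mono-<-≤ (*-monoʳ-< 2 t<m) (*-monoˡ-≤ m (lower≤1 (index t))) ⟩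
      2 * m + 1 * m                  ≡⟨ lemma′ m ⟩
      3 * m                          ∎

  doubled-AP : ∀ t₁ t₂ t₃ → Aligned (index t₁) (index t₂) (index t₃) → Congruent m (t₁ + t₃) (2 * t₂) →
    doubled t₁ + doubled t₃ ≡ 2 * doubled t₂
  doubled-AP t₁ t₂ t₃ (l₁≡l₃ , same , forward , backward) t₁+t₃≡2t₂ = doubled-midpoint m t₁ t₂ t₃ l₁≡l₃ (go t₁+t₃≡2t₂)
    where
    go : Congruent m (t₁ + t₃) (2 * t₂) → _ ⊎ _ ⊎ _
    go (inj₁ eq)        = inj₁ (eq , same (near-≡ t₁ t₂ t₃ eq))
    go (inj₂ (inj₁ eq)) = inj₂ (inj₁ (eq , forward (near-forward t₁ t₂ t₃ eq)))
    go (inj₂ (inj₂ eq)) = inj₂ (inj₂ (eq , backward (near-backward t₁ t₂ t₃ eq)))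

  doubled-injective : ∀ t t′ → lower (index t) ≡ lower (index t′) → doubled t ≡ doubled t′ → t ≡ t′
  doubled-injective t t′ l≡l′ d≡d′ = *-cancelˡ-≡ t t′ 2 (+-cancelʳ-≡ (lower (index t′) * m) (2 * t) (2 * t′)
    (trans (cong (λ l → 2 * t + l * m) (sym l≡l′)) d≡d′))

  ConvexAt : ℕ → ℕ → ℕ → ℕ → ℕ → ℕ → Set
  ConvexAt s₁ t₁ s₂ t₂ s₃ t₃ = ((s₁ ≡ s₃ × t₁ ≡ t₃) × φ s₁ t₁ ≡ φ s₂ t₂) ⊎ 2 * φ s₂ t₂ < φ s₁ t₁ + φ s₃ t₃

  -- The doubled representatives form a progression in ℕ. If it is constant then t₁ = t₃, while t₂
  -- may differ from them by m/2; φ takes the same value at both.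
  φ-convex-sameRow : ∀ s t₁ t₂ t₃ → Aligned (index t₁) (index t₂) (index t₃) → Congruent m (t₁ + t₃) (2 * t₂) →
    ConvexAt s t₁ s t₂ s t₃
  φ-convex-sameRow s t₁ t₂ t₃ aligned tt with doubled t₁ ≟ doubled t₃
  ... | no d₁≢d₃  = inj₂ (potential-strict₂ (18 * (m * m)) s (doubled t₁) (doubled t₂) (doubled t₃) d₁≢d₃ (doubled-AP t₁ t₂ t₃ aligned tt))
  ... | yes d₁≡d₃ = inj₁ ((refl , doubled-injective t₁ t₃ (proj₁ aligned) d₁≡d₃) , cong (potential (18 * (m * m)) s) d₁≡d₂)
    where
    d₁≡d₂ : doubled t₁ ≡ doubled t₂
    d₁≡d₂ = *-cancelˡ-≡ (doubled t₁) (doubled t₂) 2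
      (trans (cong (doubled t₁ +_) (trans (+-identityʳ (doubled t₁)) d₁≡d₃)) (doubled-AP t₁ t₂ t₃ aligned tt))

  -- Unless all three s agree, s² decides: an exact midpoint is strictly convex, a forward wrap
  -- raises the outer terms, and a backward wrap contradicts the choice of cells.
  φ-convex : ∀ s₁ t₁ s₂ t₂ s₃ t₃ {c₁ c₂ c₃} → c₁ ∈ cells → c₂ ∈ cells → c₃ ∈ cells →
    InCell s₁ t₁ c₁ → InCell s₂ t₂ c₂ → InCell s₃ t₃ c₃ → t₂ < m →
    Congruent m (s₁ + s₃) (2 * s₂) → Congruent m (t₁ + t₃) (2 * t₂) → ConvexAt s₁ t₁ s₂ t₂ s₃ t₃
  φ-convex s₁ t₁ s₂ t₂ s₃ t₃ {c₁} {c₂} {c₃} ∈₁ ∈₂ ∈₃ (i₁ , j₁) (i₂ , j₂) (i₃ , j₃) t₂<m ss tt = go ss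
    where
    nearMod : NearMod (toℕ (proj₂ c₁) + toℕ (proj₂ c₃)) (2 * toℕ (proj₂ c₂))
    nearMod = subst₂ NearMod (cong₂ _+_ j₁ j₃) (cong (2 *_) j₂) (congruent⇒nearMod t₁ t₂ t₃ tt)
    aligned : proj₁ c₁ ≡ proj₁ c₂ → proj₁ c₃ ≡ proj₁ c₂ → Aligned (index t₁) (index t₂) (index t₃)
    aligned r₁ r₃ = subst (λ J → Aligned J (index t₂) (index t₃)) (sym j₁)
      (subst₂ (Aligned (toℕ (proj₂ c₁))) (sym j₂) (sym j₃)
        (All.lookup (All.lookup (All.lookup rowAligned ∈₁) ∈₂) ∈₃ r₁ r₃ nearMod))
    strict₁ = potential-strict₁ (18 * (m * m)) s₁ s₂ s₃ (doubled t₁) (doubled t₂) (doubled t₃)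
    go : Congruent m (s₁ + s₃) (2 * s₂) → ConvexAt s₁ t₁ s₂ t₂ s₃ t₃
    go (inj₁ eq) with s₁ ≟ s₃
    ... | no s₁≢s₃ = inj₂ (strict₁ (2*doubled²<18m² t₂ t₂<m) (midpoint²< {b = s₂} s₁≢s₃ eq))
    -- Equal outer terms force s₂ = s₁, so the three cells lie in one row and t decides.
    ... | yes refl with refl ← *-cancelˡ-≡ s₁ s₂ 2 (trans (cong (s₁ +_) (+-identityʳ s₁)) eq) =
      φ-convex-sameRow s₁ t₁ t₂ t₃ (aligned (toℕ-injective (trans (sym i₁) i₂)) (toℕ-injective (trans (sym i₃) i₂))) tt
    go (inj₂ (inj₁ eq)) = inj₂ (strict₁ (2*doubled²<18m² t₂ t₂<m)
      (2b<a+c⇒2b²<a²+c² {s₁} {s₂} {s₃} (<-≤-trans (m<m+n (2 * s₂) (>-nonZero⁻¹ m)) (≤-reflexive (sym eq)))))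
    go (inj₂ (inj₂ eq)) = contradiction (near , nearMod) (All.lookup (All.lookup (All.lookup noBackwardWrap ∈₁) ∈₂) ∈₃)
      where
      near : Near (toℕ (proj₁ c₁) + toℕ (proj₁ c₃) + 8) (2 * toℕ (proj₁ c₂))
      near = subst₂ Near (cong (_+ 8) (cong₂ _+_ i₁ i₃)) (cong (2 *_) i₂) (near-backward s₁ s₂ s₃ eq)

  -- Points of the cells and their number

  -- Each grid interval contains at least ⌊m/8⌋ residues; taking exactly that many gives all cells
  -- the same size.
  q : ℕ
  q = m / 8

  8q≤m : 8 * q ≤ m
  8q≤m = ≤-trans (≤-reflexive (*-comm 8 q)) (m/n*n≤m m 8)

  -- The ceiling of m i / 8, the first residue of the i-th interval.
  corner : ℕ → ℕ
  corner i = (m * i + 7) / 8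

  corner-lo : ∀ i → m * i ≤ 8 * corner i
  corner-lo i = +-cancelˡ-≤ 7 _ _ (begin
    7 + m * i                            ≡⟨ +-comm 7 (m * i) ⟩
    m * i + 7                            ≡⟨ m≡m%n+[m/n]*n (m * i + 7) 8 ⟩
    (m * i + 7) % 8 + corner i * 8       ≤⟨ +-mono-≤ (s≤s⁻¹ (m%n<n (m * i + 7) 8)) (≤-reflexive (*-comm (corner i) 8)) ⟩
    7 + 8 * corner i                     ∎)
    where open ≤-Reasoning

  corner-hi : ∀ i → 8 * corner i ≤ m * i + 7
  corner-hi i = ≤-trans (≤-reflexive (*-comm 8 (corner i))) (m/n*n≤m (m * i + 7) 8)

  -- Rounding the corner up costs at most 7 on the scale of `8 * x`, while `a < q` leaves a slack of
  -- 8.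
  8*[corner+a]<m*[1+i] : ∀ i {a} → a < q → 8 * (corner i + a) < m * suc i
  8*[corner+a]<m*[1+i] i {a} a<q = +-cancelʳ-≤ 7 _ _ (begin
    suc (8 * (corner i + a)) + 7     ≡⟨ lemma (corner i) a ⟩
    8 * corner i + 8 * suc a         ≤⟨ +-mono-≤ (corner-hi i) (≤-trans (*-monoʳ-≤ 8 a<q) 8q≤m) ⟩
    m * i + 7 + m                    ≡⟨ lemma′ m i ⟩
    m * suc i + 7                    ∎)
    where
    open ≤-Reasoning
    lemma : ∀ x a → suc (8 * (x + a)) + 7 ≡ 8 * x + 8 * suc a
    lemma = solve-∀
    lemma′ : ∀ m i → m * i + 7 + m ≡ m * suc i + 7
    lemma′ = solve-∀

  corner+a<m : ∀ (i : Fin 8) {a} → a < q → corner (toℕ i) + a < m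
  corner+a<m i {a} a<q = *-cancelˡ-< 8 _ _ (begin-strict
    8 * (corner (toℕ i) + a)   <⟨ 8*[corner+a]<m*[1+i] (toℕ i) a<q ⟩
    m * suc (toℕ i)            ≤⟨ *-monoʳ-≤ m (toℕ<n i) ⟩
    m * 8                      ≡⟨ *-comm m 8 ⟩
    8 * m                      ∎)
    where open ≤-Reasoning

  point : Fin 8 → Fin q → ℤmod m
  point i a = fromℕ< (corner+a<m i (toℕ<n a))

  toℕ-point : ∀ i a → toℕ (point i a) ≡ corner (toℕ i) + toℕ a
  toℕ-point i a = toℕ-fromℕ< (corner+a<m i (toℕ<n a))

  index-point : ∀ i a → index (toℕ (point i a)) ≡ toℕ i
  index-point i a = trans (cong index (toℕ-point i a)) (index-unique {corner (toℕ i) + toℕ a}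
    (≤-trans (corner-lo (toℕ i)) (*-monoʳ-≤ 8 (m≤m+n (corner (toℕ i)) (toℕ a))))
    (8*[corner+a]<m*[1+i] (toℕ i) (toℕ<n a)))

  point-injective : ∀ i j a b → point i a ≡ point j b → i ≡ j × a ≡ b
  point-injective i j a b eq = i≡j , toℕ-injective (+-cancelˡ-≡ (corner (toℕ i)) (toℕ a) (toℕ b) (begin
    corner (toℕ i) + toℕ a    ≡⟨ toℕ-point i a ⟨
    toℕ (point i a)           ≡⟨ cong toℕ eq ⟩
    toℕ (point j b)           ≡⟨ toℕ-point j b ⟩
    corner (toℕ j) + toℕ b    ≡⟨ cong (λ k → corner (toℕ k) + toℕ b) i≡j ⟨
    corner (toℕ i) + toℕ b    ∎))
    where
    open ≡-Reasoning
    i≡j : i ≡ j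
    i≡j = toℕ-injective (trans (sym (index-point i a)) (trans (cong (λ x → index (toℕ x)) eq) (index-point j b)))

  planePoint : Cell × (Fin q × Fin q) → ℤmod^ m 2
  planePoint ((i , j) , (a , b)) = point i a ∷ point j b ∷ []

  planePoint-injective : ∀ {p p′} → planePoint p ≡ planePoint p′ → p ≡ p′
  planePoint-injective {(i , j) , (a , b)} {(i′ , j′) , (a′ , b′)} eq =
    cong₂ _,_ (cong₂ _,_ (proj₁ first) (proj₁ second)) (cong₂ _,_ (proj₂ first) (proj₂ second))
    where
    first  = point-injective i i′ a a′ (Vec.∷-injectiveˡ eq)
    second = point-injective j j′ b b′ (Vec.∷-injectiveˡ (Vec.∷-injectiveʳ eq))

  places : List (Cell × (Fin q × Fin q))
  places = cartesianProduct cells (cartesianProduct (allFin q) (allFin q))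

  block : List (ℤmod^ m 2)
  block = List.map planePoint places

  block! : Unique block
  block! = Unique.map⁺ planePoint-injective (Unique.cartesianProduct⁺ cells! (Unique.cartesianProduct⁺ (Unique.allFin⁺ q) (Unique.allFin⁺ q)))

  φᵥ : ℤmod^ m 2 → ℕ
  φᵥ (s ∷ t ∷ []) = φ (toℕ s) (toℕ t)

  planePoint-convex : ∀ p₁ p₂ p₃ → proj₁ p₁ ∈ cells → proj₁ p₂ ∈ cells → proj₁ p₃ ∈ cells →
    planePoint p₁ -ᵥ 2 ·ᵥ planePoint p₂ +ᵥ planePoint p₃ ≡ 0ᵥ →
    StrictlyConvexAt φᵥ (planePoint p₁) (planePoint p₂) (planePoint p₃)
  planePoint-convex ((i₁ , j₁) , (a₁ , b₁)) ((i₂ , j₂) , (a₂ , b₂)) ((i₃ , j₃) , (a₃ , b₃)) ∈₁ ∈₂ ∈₃ eq =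
    Sum.map₁ (λ ((s≡ , t≡) , φ≡) → cong₂ (λ s t → s ∷ t ∷ []) (toℕ-injective s≡) (toℕ-injective t≡) , φ≡)
      (φ-convex (toℕ s₁) (toℕ t₁) (toℕ s₂) (toℕ t₂) (toℕ s₃) (toℕ t₃) ∈₁ ∈₂ ∈₃
        (index-point i₁ a₁ , index-point j₁ b₁) (index-point i₂ a₂ , index-point j₂ b₂) (index-point i₃ a₃ , index-point j₃ b₃)
        (toℕ<n t₂)
        (AP⇒congruent s₁ s₂ s₃ (Vec.∷-injectiveˡ eq))
        (AP⇒congruent t₁ t₂ t₃ (Vec.∷-injectiveˡ (Vec.∷-injectiveʳ eq))))
    where
    s₁ = point i₁ a₁
    t₁ = point j₁ b₁
    s₂ = point i₂ a₂
    t₂ = point j₂ b₂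
    s₃ = point i₃ a₃
    t₃ = point j₃ b₃

  block⊆planePoints : ∀ {x} → x ∈ block → ∃[ p ] proj₁ p ∈ cells × x ≡ planePoint p
  block⊆planePoints x∈ = let p , p∈ , x≡ = ∈-map⁻ planePoint x∈ in
    p , proj₁ (∈-cartesianProduct⁻ cells (cartesianProduct (allFin q) (allFin q)) p∈) , x≡

  convex : StrictlyConvexOn block φᵥ
  convex {x} {y} {z} x∈ y∈ z∈ = go (block⊆planePoints x∈) (block⊆planePoints y∈) (block⊆planePoints z∈)
    where
    go : (∃[ p ] proj₁ p ∈ cells × x ≡ planePoint p) → (∃[ p ] proj₁ p ∈ cells × y ≡ planePoint p) →
      (∃[ p ] proj₁ p ∈ cells × z ≡ planePoint p) → x -ᵥ 2 ·ᵥ y +ᵥ z ≡ 0ᵥ → StrictlyConvexAt φᵥ x y z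
    go (p₁ , ∈₁ , refl) (p₂ , ∈₂ , refl) (p₃ , ∈₃ , refl) = planePoint-convex p₁ p₂ p₃ ∈₁ ∈₂ ∈₃

  length-block : length block ≡ 18 * (q * q)
  length-block = begin
    length block                                                      ≡⟨ length-map planePoint places ⟩
    length places                                                     ≡⟨ length-cartesianProductWith _,_ cells (cartesianProduct (allFin q) (allFin q)) ⟩
    18 * length (cartesianProduct (allFin q) (allFin q))              ≡⟨ cong (18 *_) (length-cartesianProductWith _,_ (allFin q) (allFin q)) ⟩
    18 * (length (allFin q) * length (allFin q))                      ≡⟨ cong (λ l → 18 * (l * l)) (length-tabulate {n = q} id) ⟩
    18 * (q * q)                                                      ∎
    where open ≡-Reasoning

  -- For q ≥ 16 one has 16m ≤ 16(8q + 7) ≤ 135q, and 257² · 135² < 16² · 512² · 18.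
  dense : m ≥ 128 → (257 * m) ℕ.^ 2 < length block * 512 ℕ.^ 2
  dense m≥128 = subst (λ l → (257 * m) ℕ.^ 2 < l * 512 ℕ.^ 2) (sym length-block)
    (scaled-squares-< 257 16 135 512 18 m q 16m≤135q (from-yes (257 * 257 * (135 * 135) <? 16 * 16 * (512 * 512 * 18))))
    where
    open ≤-Reasoning
    q≥16 : q ≥ 16
    q≥16 = /-monoˡ-≤ 8 m≥128
    instance
      q≢0 : NonZero q
      q≢0 = >-nonZero (≤-trans (s≤s z≤n) q≥16)
    split : ∀ q → 16 * (7 + q * 8) ≡ 7 * 16 + 128 * q
    split = solve-∀
    join : ∀ q → 7 * q + 128 * q ≡ 135 * q
    join = solve-∀
    16m≤135q : 16 * m ≤ 135 * q
    16m≤135q = begin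
      16 * m                  ≡⟨ cong (16 *_) (m≡m%n+[m/n]*n m 8) ⟩
      16 * (m % 8 + q * 8)    ≤⟨ *-monoʳ-≤ 16 (+-monoˡ-≤ (q * 8) (s≤s⁻¹ (m%n<n m 8))) ⟩
      16 * (7 + q * 8)        ≡⟨ split q ⟩
      7 * 16 + 128 * q        ≤⟨ +-monoˡ-≤ (128 * q) (*-monoʳ-≤ 7 q≥16) ⟩
      7 * q + 128 * q         ≡⟨ join q ⟩
      135 * q                 ∎

-- Both ranges of the modulus

small-modulus : ∀ m .{{_ : NonZero m}} → m ≥ 2 → m < 256 → HasLargeSets m
small-modulus m m≥2 m<256 = hasLargeSets {B = H.block} {H.φ} H.block! H.convex (H.dense m<256)
  where module H = HalfInterval m m≥2

large-modulus : ∀ m .{{_ : NonZero m}} → m ≥ 128 → HasLargeSets m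
large-modulus m m≥128 = hasLargeSets {B = CellSet.block m} {CellSet.φᵥ m}
  (CellSet.block! m) (CellSet.convex m) (CellSet.dense m m≥128)

theorem1p2 : ∃[ c ] c ℚ.> ½ ×
    (∀ (m : ℕ) .{{_ : NonZero m}} → m ≥ 2 →
    ∃[ n₀ ] (∀ (n : ℕ) → n ≥ n₀ →
    ∃[ A ] Unique {A = ℤmod^ m n} A × ThreeAPFree A ×
    fromℕ (length A) ℚ.≥ (c ℚ.* fromℕ m) ^ n))
theorem1p2 = c₀ , from-yes (½ ℚ.<? c₀) , λ m m≥2 →
  -- The half interval is dense enough up to 255 and the cells from 128 on, so the split at 256 lies
  -- within reach of both.
  [ small-modulus m m≥2 , (λ m≥256 → large-modulus m (≤-trans (m≤m+n 128 128) m≥256)) ]′ (<-≤-connex m 256)
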